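{- Let $G$ be a simple 2-connected graph, and let $e$ and $f$ be distinct edges of $G$. If every cycle of $G$ containing both $e$ and $f$ is Hamiltonian, then $G$ is a clean ladder.
   Context: All graphs are finite. A cycle of $G$ is Hamiltonian if it contains every vertex of $G$. Let $B_3$ denote the graph consisting of two vertices joined by three edges. A 2-sum of two graphs with basepoint $p$, where $p$ is the unique common edge of the two otherwise disjoint graphs, is obtained by identifying the two copies of $p$ (with their end-vertices identified, in either of the two possible ways) and then deleting the edge $p$. A graph $L$ is a clean ladder if it can be constructed (up to isomorphism), by taking successive 2-sums, via a path decomposition whose vertices are labeled, in order, by graphs $G_0,G_1,\dots,G_n$ ($n\ge 0$) where: (i) each $G_i$ is isomorphic to $K_4$, $K_3$, or $B_3$; (ii) each edge of the path is the basepoint of the 2-sum between its endpoints (so consecutive $G_{i-1}$, $G_i$ share exactly one edge, the basepoint $p_i$; non-consecutive ones share none; and for $0<i<n$ the two basepoints of $G_i$ are distinct edges of $G_i$); (iii) neither $G_0$ nor $G_n$ is isomorphic to $B_3$; (iv) no two consecutive vertices of the path are both isomorphic to $B_3$; and (v) whenever $0<i<n$ and $G_i\cong K_4$, the two edges of $G_i$ that are basepoints of 2-sums form a matching. (When $n=0$, $L=G_0$.) -}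

module Defs where

open import Data.Fin.Base using (Fin; zero; suc; inject₁; fromℕ)
open import Data.Fin.Patterns using (0F; 1F; 2F; 3F)
open import Data.Nat.Base using (ℕ; _≤_)
open import Data.Product.Base using (Σ; ∃; _×_; _,_; proj₁; proj₂; map; swap)
open import Data.Sum.Base using (_⊎_; inj₁; inj₂)
open import Data.Unit.Base using (⊤)
open import Data.Vec.Base using (_∷_; []; lookup)
open import Function.Base using (const)
open import Function.Bundles using (_↔_; Inverse)
open import Function.Definitions using (Injective)
open import Relation.Binary.Construct.Closure.ReflexiveTransitive using (Star)
open import Relation.Binary.PropositionalEquality using (_≡_; _≢_)
open import Relation.Nullary.Negation using (¬_)

-- Loops and parallel edges are allowed.  The order within the pair `ends e`
-- carries no meaning: ends are only ever compared up to _≈_ below.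
record Graph : Set where
  field
    order size : ℕ
    ends       : Fin size → Fin order × Fin order

open Graph public using (ends)

Vertex : Graph → Set
Vertex G = Fin (Graph.order G)

Edge : Graph → Set
Edge G = Fin (Graph.size G)

infix 4 _≈_ _∈ₚ_

_≈_ : {A : Set} → A × A → A × A → Set
x ≈ y = x ≡ y ⊎ x ≡ swap y

_∈ₚ_ : {A : Set} → A → A × A → Set
a ∈ₚ (x , y) = a ≡ x ⊎ a ≡ y

mapₚ : {A B : Set} → (A → B) → A × A → B × B
mapₚ f = map f f

Simple : Graph → Set
Simple G = (∀ e → proj₁ (ends G e) ≢ proj₂ (ends G e))
         × (∀ {e f} → ends G e ≈ ends G f → e ≡ f)

-- Any two vertices satisfying P are joined by a walk all of whose vertices
-- satisfy P, i.e. the subgraph induced by P is connected (or empty).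
ConnectedOn : (G : Graph) → (Vertex G → Set) → Set
ConnectedOn G P = ∀ {u v} → P u → P v → Star Step u v
  where
  Step : Vertex G → Vertex G → Set
  Step x y = P x × P y × ∃ λ e → ends G e ≈ (x , y)

TwoConnected : Graph → Set
TwoConnected G = 3 ≤ Graph.order G
               × ConnectedOn G (const ⊤)
               × (∀ x → ConnectedOn G (_≢ x))

-- The edge at position i joins the vertices at positions i and i + 1, cyclically.
-- Distinctness of the edges matters only for length two.
record Cycle (G : Graph) : Set where
  field
    {last}           : ℕ
    vertex           : Fin (ℕ.suc last) → Vertex G
    edge             : Fin (ℕ.suc last) → Edge G
    vertex-injective : Injective _≡_ _≡_ vertex
    edge-injective   : Injective _≡_ _≡_ edge
    consecutive      : ∀ (i : Fin last) →
                       ends G (edge (inject₁ i)) ≈ (vertex (inject₁ i) , vertex (suc i))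
    closing          : ends G (edge (fromℕ last)) ≈ (vertex (fromℕ last) , vertex zero)

_∈ᴱ_ : {G : Graph} → Edge G → Cycle G → Set
e ∈ᴱ C = ∃ λ i → Cycle.edge C i ≡ e

Hamiltonian : {G : Graph} → Cycle G → Set
Hamiltonian C = ∀ v → ∃ λ i → Cycle.vertex C i ≡ v

infix 4 _≅_

record _≅_ (G H : Graph) : Set where
  field
    vertices : Vertex G ↔ Vertex H
    edges    : Edge G ↔ Edge H
    ends-≈   : ∀ e → ends H (Inverse.to edges e) ≈ mapₚ (Inverse.to vertices) (ends G e)

data Shape : Set where
  K₄ K₃ B₃ : Shape

⟦_⟧ : Shape → Graph
⟦ K₄ ⟧ = record
  { ends = lookup ((0F , 1F) ∷ (0F , 2F) ∷ (0F , 3F) ∷ (1F , 2F) ∷ (1F , 3F) ∷ (2F , 3F) ∷ [])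
  ; order = 4 }
⟦ K₃ ⟧ = record
  { ends = lookup ((0F , 1F) ∷ (0F , 2F) ∷ (1F , 2F) ∷ [])
  ; order = 3 }
⟦ B₃ ⟧ = record
  { ends = lookup ((0F , 1F) ∷ (0F , 1F) ∷ (0F , 1F) ∷ [])
  ; order = 2 }

-- L is a 2-sum of G and H, where the edge p of G and the edge q of H are the two
-- copies of the basepoint.  The vertex sets of G and H are embedded in that of L,
-- overlapping exactly in the ends of the basepoint; _≈_ in `glue` allows either of
-- the two identifications.  The edges of L are those of G and H except p and q.
record TwoSum (G : Graph) (p : Edge G) (H : Graph) (q : Edge H) (L : Graph) : Set where
  field
    vertexˡ           : Vertex G → Vertex L
    vertexʳ           : Vertex H → Vertex L
    vertexˡ-injective : Injective _≡_ _≡_ vertexˡ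
    vertexʳ-injective : Injective _≡_ _≡_ vertexʳ
    cover             : ∀ x → (∃ λ u → vertexˡ u ≡ x) ⊎ (∃ λ w → vertexʳ w ≡ x)
    glue              : mapₚ vertexˡ (ends G p) ≈ mapₚ vertexʳ (ends H q)
    common-ends       : ∀ {u w} → vertexˡ u ≡ vertexʳ w → u ∈ₚ ends G p × w ∈ₚ ends H q
    edges             : (Σ (Edge G) (_≢ p) ⊎ Σ (Edge H) (_≢ q)) ↔ Edge L

  edgeˡ : (a : Edge G) → a ≢ p → Edge L
  edgeˡ a a≢p = Inverse.to edges (inj₁ (a , a≢p))

  edgeʳ : (b : Edge H) → b ≢ q → Edge L
  edgeʳ b b≢q = Inverse.to edges (inj₂ (b , b≢q))

  field
    endsˡ : ∀ a a≢p → ends L (edgeˡ a a≢p) ≈ mapₚ vertexˡ (ends G a)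
    endsʳ : ∀ b b≢q → ends L (edgeʳ b b≢q) ≈ mapₚ vertexʳ (ends H b)

Matching : (G : Graph) → Edge G → Edge G → Set
Matching G q r = ∀ v → v ∈ₚ ends G q → ¬ (v ∈ₚ ends G r)

-- `Partial L p s`: L is the successive 2-sum of the labels G₀, …, Gᵢ of an initial
-- segment of the path, which is to be continued; s is the isomorphism type of Gᵢ,
-- and p is the edge of Gᵢ (still present in L) chosen as the basepoint pᵢ₊₁.
data Partial : (L : Graph) → Edge L → Shape → Set where
  start : ∀ {G₀ s} → G₀ ≅ ⟦ s ⟧ → s ≢ B₃ → (p : Edge G₀) → Partial G₀ p s
  -- In H = Gᵢ the basepoints are q (shared with Gᵢ₋₁) and r (to be shared with Gᵢ₊₁).
  extend : ∀ {L p s H t L′} → Partial L p s →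
           H ≅ ⟦ t ⟧ →
           ¬ (s ≡ B₃ × t ≡ B₃) →
           (q r : Edge H) (r≢q : r ≢ q) →
           (t ≡ K₄ → Matching H q r) →
           (S : TwoSum L p H q L′) →
           ∀ {p′} → p′ ≡ TwoSum.edgeʳ S r r≢q →
           Partial L′ p′ t

-- In `finish` the last two labels are not both B₃, since the last one is not.
-- Closure under isomorphism is built in, as _≅_ and TwoSum determine a graph only
-- up to isomorphism.
data CleanLadder : Graph → Set where
  single : ∀ {L s} → L ≅ ⟦ s ⟧ → s ≢ B₃ → CleanLadder L
  finish : ∀ {L p s H t L′} → Partial L p s →
           H ≅ ⟦ t ⟧ → t ≢ B₃ →
           (q : Edge H) →
           TwoSum L p H q L′ →
           CleanLadder L′

{-# OPTIONS --safe #-}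

-- By 2-connectivity, e and f lie on a common cycle, which consists of e, f and two
-- disjoint paths P and Q from the ends of e to the ends of f.  As shortcuts through
-- chords are forbidden, every other edge joins P to Q, and two such rungs x w and y z
-- that cross must join consecutive vertices x z of P to consecutive vertices y w of Q.
-- So one can sweep along P and Q, keeping a current rung x y (real or virtual): if x
-- has no neighbour ahead on Q, glue a triangle and advance on P; if y has none ahead
-- on P, advance on Q; otherwise x, y and their successors carry a K₄, and both advance.
-- A B₃ is inserted before the step whenever the current rung is an edge of G.
module Submission where

open import Defs
open import Data.Empty using (⊥)
open import Data.Fin.Base using (Fin; zero; suc; inject₁; fromℕ)
open import Data.Fin.Patterns using (0F; 1F; 2F; 3F; 4F; 5F)
open import Data.Fin.Properties using (_≟_; any?; suc-injective)
open import Data.List.Base using (List; []; _∷_; length; lookup)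
import Data.List.Membership.DecPropositional as DecMembership
open import Data.List.Membership.Propositional using (_∈_; _∉_; find; lose)
open import Data.List.Membership.Propositional.Properties using (∈-lookup)
open import Data.List.Relation.Binary.Disjoint.Propositional using (Disjoint)
open import Data.List.Relation.Binary.Subset.Propositional using (_⊆_)
open import Data.List.Relation.Unary.Any as Any using (Any; here; there)
open import Data.Nat.Base using (ℕ)
open import Data.Product.Base using (Σ; ∃; _×_; _,_; proj₁; proj₂)
open import Data.Product.Properties using (≡-dec)
open import Data.Sum.Base as Sum using (_⊎_; inj₁; inj₂; [_,_]′)
open import Data.Unit.Base using (⊤; tt)
open import Data.Vec.Functional as Vector using (Vector)
open import Function.Base using (_∘_; id)
open import Function.Bundles using (_↔_; Inverse; Injection; mk↔ₛ′)
open import Function.Definitions using (Injective)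
open import Function.Properties.Inverse using (↔-sym; ↔-trans; ↔⇒↣)
open import Relation.Binary.Construct.Closure.ReflexiveTransitive using (Star; ε; _◅_)
open import Relation.Binary.PropositionalEquality
  using (_≡_; _≢_; refl; sym; trans; cong; cong₂; subst)
open import Relation.Nullary using (¬_; Dec; yes; no; contradiction)
open import Relation.Nullary.Decidable using (toSum; _⊎-dec_)

-- A 2-sum deletes its basepoint, so a rung that is an edge of $G$ would be lost when the sweep
-- passes it. Summing with a B₃ doubles it: one copy stays for good, the other is the next
-- basepoint. Each rung gets at most one B₃, and only when a K₃ or K₄ is to follow, so no two B₃ are
-- consecutive and none ends the path. The edge e cannot be doubled in this way, as no label
-- precedes it; the sweep starts instead from a digon, which a 2-sum absorbs, so that the first K₃
-- or K₄ becomes G₀. Every K₃ or K₄ may turn out to be the last label. Its far edge therefore has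
-- two readings: it is the next basepoint or, when both paths are used up, the edge f itself. A
-- chord of P shortens the cycle at once, but a single rung does not, since it leads to the wrong
-- end of f. Two crossing rungs exchange the ends and give a new pair of paths, which skips whatever
-- lies between them; hence nothing does. A triangle may leave x behind only when no rung from x is
-- still to come. A K₄ may leave both x and y behind, because each then has no neighbour ahead
-- outside the K₄.

private variable
  A B : Set
  G H L L′ : Graph
  n m : ℕ
  s : Shape

-- Unordered pairs and isomorphisms of graphs.

≈-refl : {x : A × A} → x ≈ x
≈-refl = inj₁ refl

≈-sym : {x y : A × A} → x ≈ y → y ≈ x
≈-sym (inj₁ refl) = inj₁ refl
≈-sym (inj₂ refl) = inj₂ refl

≈-trans : {x y z : A × A} → x ≈ y → y ≈ z → x ≈ z
≈-trans (inj₁ refl) y≈z         = y≈z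
≈-trans (inj₂ refl) (inj₁ refl) = inj₂ refl
≈-trans (inj₂ refl) (inj₂ refl) = inj₁ refl

≈-swapʳ : {x : A × A} {a b : A} → x ≈ (a , b) → x ≈ (b , a)
≈-swapʳ x≈ab = ≈-trans x≈ab (inj₂ refl)

≈-∈ₚ : {x : A × A} {a b : A} → x ≈ (a , b) → a ∈ₚ x
≈-∈ₚ (inj₁ refl) = inj₁ refl
≈-∈ₚ (inj₂ refl) = inj₂ refl

≈-map : (f : A → B) {x y : A × A} → x ≈ y → mapₚ f x ≈ mapₚ f y
≈-map f (inj₁ refl) = inj₁ refl
≈-map f (inj₂ refl) = inj₂ refl

≈-pair : {a b c d : A} {x : A × A} → x ≈ (a , b) → x ≈ (c , d) →
         (a ≡ c × b ≡ d) ⊎ (a ≡ d × b ≡ c)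
≈-pair (inj₁ refl) (inj₁ refl) = inj₁ (refl , refl)
≈-pair (inj₁ refl) (inj₂ refl) = inj₂ (refl , refl)
≈-pair (inj₂ refl) (inj₁ refl) = inj₂ (refl , refl)
≈-pair (inj₂ refl) (inj₂ refl) = inj₁ (refl , refl)

∷-injective : ∀ {A : Set} {n} {x : A} {xs : Vector A n} → ¬ (∃ λ i → xs i ≡ x) →
              Injective _≡_ _≡_ xs → Injective _≡_ _≡_ (x Vector.∷ xs)
∷-injective x∉ inj {zero}  {zero}  _  = refl
∷-injective x∉ inj {zero}  {suc j} eq = contradiction (j , sym eq) x∉
∷-injective x∉ inj {suc i} {zero}  eq = contradiction (i , eq) x∉
∷-injective x∉ inj {suc i} {suc j} eq = cong suc (inj eq)

iso : (ι : Vertex L → Vertex G) → Injective _≡_ _≡_ ι → (∀ v → ∃ λ u → ι u ≡ v) →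
      (κ : Edge L → Edge G) → Injective _≡_ _≡_ κ → (∀ g → ∃ λ k → κ k ≡ g) →
      (∀ k → ends G (κ k) ≈ mapₚ ι (ends L k)) → L ≅ G
iso ι ι-inj ι-surj κ κ-inj κ-surj compat = record
  { vertices = bijection ι ι-inj ι-surj
  ; edges    = bijection κ κ-inj κ-surj
  ; ends-≈   = compat
  }
  where
  bijection : (f : A → B) → Injective _≡_ _≡_ f → (∀ y → ∃ λ x → f x ≡ y) → A ↔ B
  bijection f inj surj =
    mk↔ₛ′ f (proj₁ ∘ surj) (proj₂ ∘ surj) (λ x → inj (proj₂ (surj (f x))))

≅-sym : G ≅ H → H ≅ G
≅-sym {G} {H} φ = record
  { vertices = ↔-sym vertices
  ; edges    = ↔-sym edges
  ; ends-≈   = λ e → ≈-sym (≈-trans (≈-map V.from (from-to e)) (inj₁ (cancel _)))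
  }
  where
  open _≅_ φ
  module V = Inverse vertices
  module E = Inverse edges
  from-to : ∀ e → ends H e ≈ mapₚ V.to (ends G (E.from e))
  from-to e = subst (λ h → ends H h ≈ _) (E.strictlyInverseˡ e) (ends-≈ (E.from e))
  cancel : ∀ x → mapₚ V.from (mapₚ V.to x) ≡ x
  cancel (a , b) = cong₂ _,_ (V.strictlyInverseʳ a) (V.strictlyInverseʳ b)

≅-trans : G ≅ H → H ≅ L → G ≅ L
≅-trans φ ψ = record
  { vertices = ↔-trans φ.vertices ψ.vertices
  ; edges    = ↔-trans φ.edges ψ.edges
  ; ends-≈   = λ e → ≈-trans (ψ.ends-≈ _) (≈-map (Inverse.to ψ.vertices) (φ.ends-≈ e))
  }
  where
  module φ = _≅_ φ
  module ψ = _≅_ ψ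

TwoSum-resp-≅ : ∀ {p q} → TwoSum L p H q L′ → L′ ≅ G → TwoSum L p H q G
TwoSum-resp-≅ S φ = record
  { vertexˡ           = to ∘ vertexˡ
  ; vertexʳ           = to ∘ vertexʳ
  ; vertexˡ-injective = vertexˡ-injective ∘ to-injective
  ; vertexʳ-injective = vertexʳ-injective ∘ to-injective
  ; cover             = λ x → cover-to x (cover (Inverse.from φ.vertices x))
  ; glue              = ≈-map to glue
  ; common-ends       = common-ends ∘ to-injective
  ; edges             = ↔-trans edges φ.edges
  ; endsˡ             = λ a a≢p → ≈-trans (φ.ends-≈ _) (≈-map to (endsˡ a a≢p))
  ; endsʳ             = λ b b≢q → ≈-trans (φ.ends-≈ _) (≈-map to (endsʳ b b≢q))
  }
  where
  module φ = _≅_ φ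
  open TwoSum S
  open Inverse φ.vertices using (to; strictlyInverseˡ)
  to-injective : Injective _≡_ _≡_ to
  to-injective = Injection.injective (↔⇒↣ φ.vertices)
  cover-to : ∀ x → _ → _
  cover-to x (inj₁ (u , eq)) = inj₁ (u , trans (cong to eq) (strictlyInverseˡ x))
  cover-to x (inj₂ (w , eq)) = inj₂ (w , trans (cong to eq) (strictlyInverseˡ x))

CleanLadder-resp-≅ : CleanLadder L → L ≅ G → CleanLadder G
CleanLadder-resp-≅ (single L≅s s≢B₃) φ         = single (≅-trans (≅-sym φ) L≅s) s≢B₃
CleanLadder-resp-≅ (finish P H≅t t≢B₃ q S) φ = finish P H≅t t≢B₃ q (TwoSum-resp-≅ S φ)

≅-refl : G ≅ G
≅-refl = iso (λ v → v) (λ eq → eq) (λ v → v , refl)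
             (λ g → g) (λ eq → eq) (λ g → g , refl) (λ _ → ≈-refl)

-- Growing a ladder by a 2-sum with B₃, K₃ or K₄.

-- The unit for 2-sums: two vertices joined by the basepoint and one further edge.
record Digon (L : Graph) (p : Edge L) : Set where
  field
    all-ends : ∀ u → u ∈ₚ ends L p
    other    : Edge L
    other≢   : other ≢ p
    only     : ∀ a → a ≢ p → a ≡ other
    parallel : ends L other ≈ ends L p

-- The edge `other` takes the place of the deleted `q`: gluing gives it the same ends, and it is all
-- that the digon contributes.
digon-sum : ∀ {p q} → Digon L p → TwoSum L p H q L′ → H ≅ L′
digon-sum {L} {H} {L′} {p} {q} D S =
  iso vertexʳ vertexʳ-injective onto (E.to ∘ replace)
      (replace-injective ∘ Injection.injective (↔⇒↣ edges)) onto-edges replace-ends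
  where
  open Digon D
  open TwoSum S
  module E = Inverse edges

  shared : ∀ {u} → u ∈ₚ ends L p → ∃ λ w → vertexʳ w ≡ vertexˡ u
  shared u∈ with glue
  shared (inj₁ refl) | inj₁ eq = _ , sym (cong proj₁ eq)
  shared (inj₂ refl) | inj₁ eq = _ , sym (cong proj₂ eq)
  shared (inj₁ refl) | inj₂ eq = _ , sym (cong proj₁ eq)
  shared (inj₂ refl) | inj₂ eq = _ , sym (cong proj₂ eq)

  onto : ∀ x → ∃ λ w → vertexʳ w ≡ x
  onto x with cover x
  ... | inj₁ (u , refl) = shared (all-ends u)
  ... | inj₂ w          = w

  replace : Edge H → Σ (Edge L) (_≢ p) ⊎ Σ (Edge H) (_≢ q)
  replace b with b ≟ q
  ... | yes _  = inj₁ (other , other≢)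
  ... | no b≢q = inj₂ (b , b≢q)

  replace-injective : Injective _≡_ _≡_ replace
  replace-injective {b} {c} eq with b ≟ q | c ≟ q
  replace-injective _    | yes refl | yes refl = refl
  replace-injective refl | no _     | no _     = refl
  replace-injective ()   | yes _    | no _
  replace-injective ()   | no _     | yes _

  -- Proofs of a ≢ p need no comparison, because ⊥ is definitionally irrelevant.
  replace-onto : ∀ k → ∃ λ b → replace b ≡ k
  replace-onto (inj₁ (a , a≢p)) with only a a≢p
  ... | refl = q , at-q
    where
    at-q : replace q ≡ inj₁ (other , a≢p)
    at-q with q ≟ q
    ... | yes _  = refl
    ... | no q≢q = contradiction refl q≢q
  replace-onto (inj₂ (b , b≢q)) = b , at-b
    where
    at-b : replace b ≡ inj₂ (b , b≢q)
    at-b with b ≟ q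
    ... | yes b≡q = contradiction b≡q b≢q
    ... | no _    = refl

  onto-edges : ∀ g → ∃ λ b → E.to (replace b) ≡ g
  onto-edges g with replace-onto (E.from g)
  ... | b , eq = b , trans (cong E.to eq) (E.strictlyInverseˡ g)

  replace-ends : ∀ b → ends L′ (E.to (replace b)) ≈ mapₚ vertexʳ (ends H b)
  replace-ends b with b ≟ q
  ... | yes refl = ≈-trans (endsˡ other other≢) (≈-trans (≈-map vertexˡ parallel) glue)
  ... | no b≢q   = endsʳ b b≢q

-- What can be extended at p by a K₃ or K₄: besides partial ladders, also the digon that
-- the sweep starts from, which is not a ladder itself.
data Ready (L : Graph) (p : Edge L) : Set where
  digon   : Digon L p → Ready L p
  partial : Partial L p s → Ready L p

-- The two readings of a graph that has just received a K₃ or K₄: in `ladder` the edge `p` is a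
-- genuine edge, in `part` it is the basepoint of the next 2-sum.
record Grown (L : Graph) (p : Edge L) : Set where
  constructor grown
  field
    ladder  : CleanLadder L
    {shape} : Shape
    ≢B₃     : shape ≢ B₃
    part    : Partial L p shape

-- Summing onto a digon gives back the shape itself, which becomes the label G₀; in the other case
-- the shape is a further label on the path.
grow : ∀ t {p} → Ready L p → t ≢ B₃ → (q r : Edge ⟦ t ⟧) (r≢q : r ≢ q) →
       (t ≡ K₄ → Matching ⟦ t ⟧ q r) → (S : TwoSum L p ⟦ t ⟧ q L′) →
       Grown L′ (TwoSum.edgeʳ S r r≢q)
grow t (digon D) t≢B₃ q r r≢q M S =
  grown (single (≅-sym (digon-sum D S)) t≢B₃) t≢B₃ (start (≅-sym (digon-sum D S)) t≢B₃ _)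
grow t (partial P) t≢B₃ q r r≢q M S =
  grown (finish P ≅-refl t≢B₃ q S) t≢B₃
        (extend P ≅-refl (t≢B₃ ∘ proj₂) q r r≢q M S refl)

-- The basepoint of the next 2-sum is the edge zero.
graph : Fin n × Fin n → Vector (Fin n × Fin n) m → Graph
graph {n} r es = record { order = n ; ends = r Vector.∷ es }

module _ {r : Fin n × Fin n} {es : Vector (Fin n × Fin n) m}
         {a b : Fin n} (a≢b : a ≢ b) (r≈ab : r ≈ (a , b)) where

  private
    a∈r : a ∈ₚ r
    a∈r = ≈-∈ₚ r≈ab

    b∈r : b ∈ₚ r
    b∈r = ≈-∈ₚ (≈-swapʳ r≈ab)

  -- Of the three parallel edges of B₃, one is glued to the old root, one becomes the new root and
  -- one is the permanent copy `r′` of the rung. The step leads from `Grown` to `Ready` because B₃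
  -- may neither follow another B₃ nor end the path.
  doubleRoot : ∀ {r′} → r′ ≈ (a , b) → Grown (graph r es) zero →
               Ready (graph r (r′ Vector.∷ es)) zero
  doubleRoot {r′} r′≈ (grown _ s≢B₃ P) =
    partial (extend {t = B₃} P ≅-refl (s≢B₃ ∘ proj₁) 0F 1F (λ ()) (λ ()) S refl)
    where
    onB₃ : Fin 2 → Fin n
    onB₃ 0F = a
    onB₃ 1F = b
    S : TwoSum (graph r es) zero ⟦ B₃ ⟧ 0F (graph r (r′ Vector.∷ es))
    S = record
      { vertexˡ           = λ u → u
      ; vertexʳ           = onB₃
      ; vertexˡ-injective = λ eq → eq
      ; vertexʳ-injective = λ
          { {0F} {0F} _  → refl
          ; {0F} {1F} eq → contradiction eq a≢b
          ; {1F} {0F} eq → contradiction (sym eq) a≢b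
          ; {1F} {1F} _  → refl }
      ; cover             = λ x → inj₁ (x , refl)
      ; glue              = r≈ab
      ; common-ends       = λ { {w = 0F} refl → a∈r , inj₁ refl
                              ; {w = 1F} refl → b∈r , inj₂ refl }
      ; edges             = mk↔ₛ′
          (λ { (inj₁ (zero , 0≢0)) → contradiction refl 0≢0
             ; (inj₁ (suc k , _))  → suc (suc k)
             ; (inj₂ (0F , 0≢0))   → contradiction refl 0≢0
             ; (inj₂ (1F , _))     → 0F
             ; (inj₂ (2F , _))     → 1F })
          (λ { 0F            → inj₂ (1F , λ ())
             ; 1F            → inj₂ (2F , λ ())
             ; (suc (suc k)) → inj₁ (suc k , λ ()) })
          (λ { 0F → refl ; 1F → refl ; (suc (suc k)) → refl })
          (λ { (inj₁ (zero , 0≢0)) → contradiction refl 0≢0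
             ; (inj₁ (suc k , _))  → refl
             ; (inj₂ (0F , 0≢0))   → contradiction refl 0≢0
             ; (inj₂ (1F , _))     → refl
             ; (inj₂ (2F , _))     → refl })
      ; endsˡ             = λ { zero 0≢0 → contradiction refl 0≢0 ; (suc k) _ → ≈-refl }
      ; endsʳ             = λ { 0F 0≢0 → contradiction refl 0≢0 ; 1F _ → r≈ab ; 2F _ → r′≈ }
      }

  -- The new vertex `zero` is the successor of `a`. Edge 1F of K₃ is the path edge from `a` to it,
  -- and edge 2F, towards `b`, is the new root.
  growTriangle : ∀ {r′} → r′ ≈ (zero , suc b) → Ready (graph r es) zero →
                 Grown (graph r′ ((suc a , zero) Vector.∷ mapₚ suc ∘ es)) zero
  growTriangle {r′} r′≈ R = grow K₃ R (λ ()) 0F 2F (λ ()) (λ ()) S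
    where
    onK₃ : Fin 3 → Fin (ℕ.suc n)
    onK₃ 0F = suc a
    onK₃ 1F = suc b
    onK₃ 2F = zero
    S : TwoSum (graph r es) zero ⟦ K₃ ⟧ 0F _
    S = record
      { vertexˡ           = suc
      ; vertexʳ           = onK₃
      ; vertexˡ-injective = suc-injective
      ; vertexʳ-injective = λ
          { {0F} {0F} _  → refl
          ; {0F} {1F} eq → contradiction (suc-injective eq) a≢b
          ; {1F} {0F} eq → contradiction (sym (suc-injective eq)) a≢b
          ; {1F} {1F} _  → refl
          ; {2F} {2F} _  → refl
          ; {0F} {2F} () ; {1F} {2F} () ; {2F} {0F} () ; {2F} {1F} () }
      ; cover             = λ { zero → inj₂ (2F , refl) ; (suc u) → inj₁ (u , refl) }
      ; glue              = ≈-map suc r≈ab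
      ; common-ends       = λ { {w = 0F} refl → a∈r , inj₁ refl
                              ; {w = 1F} refl → b∈r , inj₂ refl
                              ; {w = 2F} () }
      ; edges             = mk↔ₛ′
          (λ { (inj₁ (zero , 0≢0)) → contradiction refl 0≢0
             ; (inj₁ (suc k , _))  → suc (suc k)
             ; (inj₂ (0F , 0≢0))   → contradiction refl 0≢0
             ; (inj₂ (1F , _))     → 1F
             ; (inj₂ (2F , _))     → 0F })
          (λ { 0F            → inj₂ (2F , λ ())
             ; 1F            → inj₂ (1F , λ ())
             ; (suc (suc k)) → inj₁ (suc k , λ ()) })
          (λ { 0F → refl ; 1F → refl ; (suc (suc k)) → refl })
          (λ { (inj₁ (zero , 0≢0)) → contradiction refl 0≢0
             ; (inj₁ (suc k , _))  → refl
             ; (inj₂ (0F , 0≢0))   → contradiction refl 0≢0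
             ; (inj₂ (1F , _))     → refl
             ; (inj₂ (2F , _))     → refl })
      ; endsˡ             = λ { zero 0≢0 → contradiction refl 0≢0 ; (suc k) _ → ≈-refl }
      ; endsʳ             = λ { 0F 0≢0 → contradiction refl 0≢0
                              ; 1F _ → ≈-refl
                              ; 2F _ → ≈-swapʳ r′≈ }
      }

  -- Vertex 1F follows `a` and vertex 0F follows `b`. The basepoints 0F and 5F are opposite edges of
  -- K₄, as the matching condition demands; the four edges between them are the two path edges and
  -- the two crossing rungs.
  growK₄ : ∀ {r′} → r′ ≈ (1F , 0F) → Ready (graph r es) zero →
           Grown (graph r′ ((suc (suc b) , zero) Vector.∷ (suc (suc a) , zero) Vector.∷
                            mapₚ suc ∘ ((suc b , zero) Vector.∷ (suc a , zero) Vector.∷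
                                        mapₚ suc ∘ es))) zero
  growK₄ {r′} r′≈ R = grow K₄ R (λ ()) 0F 5F (λ ()) matching S
    where
    matching : K₄ ≡ K₄ → Matching ⟦ K₄ ⟧ 0F 5F
    matching _ _ (inj₁ refl) (inj₁ ())
    matching _ _ (inj₁ refl) (inj₂ ())
    matching _ _ (inj₂ refl) (inj₁ ())
    matching _ _ (inj₂ refl) (inj₂ ())
    onK₄ : Fin 4 → Fin (ℕ.suc (ℕ.suc n))
    onK₄ 0F = suc (suc a)
    onK₄ 1F = suc (suc b)
    onK₄ 2F = 1F
    onK₄ 3F = 0F
    S : TwoSum (graph r es) zero ⟦ K₄ ⟧ 0F _
    S = record
      { vertexˡ           = suc ∘ suc
      ; vertexʳ           = onK₄
      ; vertexˡ-injective = suc-injective ∘ suc-injective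
      ; vertexʳ-injective = λ
          { {0F} {0F} _  → refl
          ; {0F} {1F} eq → contradiction (suc-injective (suc-injective eq)) a≢b
          ; {1F} {0F} eq → contradiction (sym (suc-injective (suc-injective eq))) a≢b
          ; {1F} {1F} _  → refl
          ; {2F} {2F} _  → refl
          ; {3F} {3F} _  → refl
          ; {0F} {2F} () ; {1F} {2F} () ; {2F} {0F} () ; {2F} {1F} ()
          ; {0F} {3F} () ; {1F} {3F} () ; {3F} {0F} () ; {3F} {1F} ()
          ; {2F} {3F} () ; {3F} {2F} () }
      ; cover             = λ { 0F            → inj₂ (3F , refl)
                              ; 1F            → inj₂ (2F , refl)
                              ; (suc (suc u)) → inj₁ (u , refl) }
      ; glue              = ≈-map (suc ∘ suc) r≈ab
      ; common-ends       = λ { {w = 0F} refl → a∈r , inj₁ refl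
                              ; {w = 1F} refl → b∈r , inj₂ refl
                              ; {w = 2F} () ; {w = 3F} () }
      ; edges             = mk↔ₛ′
          (λ { (inj₁ (zero , 0≢0)) → contradiction refl 0≢0
             ; (inj₁ (suc k , _))  → suc (suc (suc (suc (suc k))))
             ; (inj₂ (0F , 0≢0))   → contradiction refl 0≢0
             ; (inj₂ (1F , _))     → 4F
             ; (inj₂ (2F , _))     → 2F
             ; (inj₂ (3F , _))     → 3F
             ; (inj₂ (4F , _))     → 1F
             ; (inj₂ (5F , _))     → 0F })
          (λ { 0F → inj₂ (5F , λ ())
             ; 1F → inj₂ (4F , λ ())
             ; 2F → inj₂ (2F , λ ())
             ; 3F → inj₂ (3F , λ ())
             ; 4F → inj₂ (1F , λ ())
             ; (suc (suc (suc (suc (suc k))))) → inj₁ (suc k , λ ()) })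
          (λ { 0F → refl ; 1F → refl ; 2F → refl ; 3F → refl ; 4F → refl
             ; (suc (suc (suc (suc (suc k))))) → refl })
          (λ { (inj₁ (zero , 0≢0)) → contradiction refl 0≢0
             ; (inj₁ (suc k , _))  → refl
             ; (inj₂ (0F , 0≢0))   → contradiction refl 0≢0
             ; (inj₂ (1F , _))     → refl
             ; (inj₂ (2F , _))     → refl
             ; (inj₂ (3F , _))     → refl
             ; (inj₂ (4F , _))     → refl
             ; (inj₂ (5F , _))     → refl })
      ; endsˡ             = λ { zero 0≢0 → contradiction refl 0≢0 ; (suc k) _ → ≈-refl }
      ; endsʳ             = λ { 0F 0≢0 → contradiction refl 0≢0
                              ; 1F _ → ≈-refl
                              ; 2F _ → ≈-refl
                              ; 3F _ → ≈-refl
                              ; 4F _ → ≈-refl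
                              ; 5F _ → r′≈ }
      }

-- Paths, and pairs of disjoint paths leading to f.

module Paths (G : Graph) (simple : Simple G) where

  Joins : Edge G → Vertex G → Vertex G → Set
  Joins g u v = ends G g ≈ (u , v)

  Adjacent : Vertex G → Vertex G → Set
  Adjacent u v = ∃ λ g → Joins g u v

  open DecMembership (_≟_ {Graph.order G}) using (_∈?_)

  private variable
    t t′ u v w x y : Vertex G
    g h e f : Edge G
    l l′ : List (Vertex G)

  adjacent? : ∀ u v → Dec (Adjacent u v)
  adjacent? u v = any? λ g → ≡-dec _≟_ _≟_ (ends G g) _ ⊎-dec ≡-dec _≟_ _≟_ (ends G g) _

  joins-≢ : Joins g u v → u ≢ v
  joins-≢ {g = g} (inj₁ eq) refl =
    proj₁ simple g (trans (cong proj₁ eq) (sym (cong proj₂ eq)))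
  joins-≢ {g = g} (inj₂ eq) refl =
    proj₁ simple g (trans (cong proj₁ eq) (sym (cong proj₂ eq)))

  joins-unique : Joins g u v → Joins h u v → g ≡ h
  joins-unique gj hj = proj₂ simple (≈-trans gj (≈-sym hj))

  joins-end : Joins g u v → Joins g x y → u ≡ x ⊎ u ≡ y
  joins-end gj gj′ with ≈-pair gj gj′
  ... | inj₁ (u≡x , _) = inj₁ u≡x
  ... | inj₂ (u≡y , _) = inj₂ u≡y

  -- The vertices of a Path t x l are x ∷ l.
  data Path (t : Vertex G) : Vertex G → List (Vertex G) → Set where
    []   : Path t t []
    step : ∀ g → Joins g x y → x ∉ y ∷ l → Path t y l → Path t x (y ∷ l)

  tail-from : Path t x l → v ∈ x ∷ l → ∃ λ l′ → Path t v l′ × v ∷ l′ ⊆ x ∷ l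
  tail-from p              (here refl) = _ , p , id
  tail-from (step _ _ _ p) (there v∈) with l′ , q , ⊆l ← tail-from p v∈ =
    l′ , q , there ∘ ⊆l

  -- The gain over `tail-from` is that the head `x` is left out: this is the vertex that a rerouted
  -- path will be shown to miss.
  shortcut : Path t x l → v ∈ l → ∃ λ l′ → Path t v l′ × v ∷ l′ ⊆ l
  shortcut (step _ _ _ p) v∈ = tail-from p v∈

  head∉tail : Path t x l → x ∉ l
  head∉tail (step _ _ x∉ _) = x∉

  target∈ : Path t x l → t ∈ x ∷ l
  target∈ []             = here refl
  target∈ (step _ _ _ p) = there (target∈ p)

  -- If x and y are adjacent, this is a cycle through the edge xy and f, cut open at both edges. The
  -- definition also makes sense for a virtual rung, where xy is no edge.
  record Linkage (f : Edge G) (x y : Vertex G) : Set where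
    constructor linkage
    field
      {end₁ end₂}   : Vertex G
      {tail₁ tail₂} : List (Vertex G)
      target        : Joins f end₁ end₂
      left          : Path end₁ x tail₁
      right         : Path end₂ y tail₂
      disjoint      : Disjoint (x ∷ tail₁) (y ∷ tail₂)

  open Linkage

  linkage-swap : Linkage f x y → Linkage f y x
  linkage-swap (linkage target p q disj) =
    linkage (≈-swapʳ target) q p (λ (v∈q , v∈p) → disj (v∈p , v∈q))

  -- Follow the walk from w until it first meets the linkage; if it does so on the path
  -- from y, then y is rerouted through x.
  linkage-shift : Linkage f x y → Adjacent y x → Adjacent y w →
                  Star (λ u v → u ≢ y × v ≢ y × Adjacent u v) w x → Linkage f w y
  linkage-shift {x = x} {y = y} Λ (h , hj) (_ , yw) walk =
    [ (λ (_ , p , disj) → linkage (target Λ) p (right Λ) disj)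
    , (λ (_ , q , y∉q , disj) → linkage (≈-swapʳ (target Λ)) q
        (step h hj (λ y∈ → disjoint Λ (y∈ , here refl)) (left Λ))
        λ { (v∈q , here refl) → y∉q v∈q ; (v∈q , there v∈p) → disj (v∈q , v∈p) })
    ]′ (meet walk (joins-≢ yw ∘ sym))
    where
    -- In the second case y will be put in front of the path from x, so the new path has to avoid y
    -- too.
    Meets : Vertex G → Set
    Meets w = (∃ λ k → Path (end₁ Λ) w k × Disjoint (w ∷ k) (y ∷ tail₂ Λ))
            ⊎ (∃ λ k → Path (end₂ Λ) w k × y ∉ w ∷ k × Disjoint (w ∷ k) (x ∷ tail₁ Λ))

    -- The walk may visit w again. The path already found then runs through w and is cut there
    -- instead of being lengthened.
    prepend : ∀ {w v} → w ≢ y → w ∉ x ∷ tail₁ Λ → w ∉ y ∷ tail₂ Λ → Joins g w v →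
              Meets v → Meets w
    prepend {w = w} {v = v} w≢y w∉p w∉q j (inj₁ (k , p , disj)) with w ∈? v ∷ k
    ... | yes w∈ with k′ , p′ , ⊆k ← tail-from p w∈ =
      inj₁ (k′ , p′ , λ (v∈ , v∈q) → disj (⊆k v∈ , v∈q))
    ... | no w∉ = inj₁ (_ , step _ j w∉ p ,
      λ { (here refl , v∈q) → w∉q v∈q ; (there v∈ , v∈q) → disj (v∈ , v∈q) })
    prepend {w = w} {v = v} w≢y w∉p w∉q j (inj₂ (k , q , y∉ , disj)) with w ∈? v ∷ k
    ... | yes w∈ with k′ , q′ , ⊆k ← tail-from q w∈ =
      inj₂ (k′ , q′ , y∉ ∘ ⊆k , λ (v∈ , v∈p) → disj (⊆k v∈ , v∈p))
    ... | no w∉ = inj₂ (_ , step _ j w∉ q ,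
      (λ { (here refl) → w≢y refl ; (there y∈) → y∉ y∈ }) ,
      λ { (here refl , v∈p) → w∉p v∈p ; (there v∈ , v∈p) → disj (v∈ , v∈p) })

    meet : ∀ {w} → Star (λ u v → u ≢ y × v ≢ y × Adjacent u v) w x → w ≢ y → Meets w
    meet {w = w} walk w≢y with w ∈? x ∷ tail₁ Λ
    ... | yes w∈p with k , p , ⊆p ← tail-from (left Λ) w∈p =
      inj₁ (k , p , λ (v∈ , v∈q) → disjoint Λ (⊆p v∈ , v∈q))
    meet {w = w} walk w≢y | no w∉p with w ∈? y ∷ tail₂ Λ
    ... | yes (here w≡y) = contradiction w≡y w≢y
    ... | yes (there w∈q) with k , q , ⊆q ← shortcut (right Λ) w∈q =
      inj₂ (k , q , head∉tail (right Λ) ∘ ⊆q ,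
            λ (v∈ , v∈p) → disjoint Λ (v∈p , there (⊆q v∈)))
    meet ε w≢y | no w∉p | no w∉q = contradiction (here refl) w∉p
    meet ((_ , v≢y , _ , wv) ◅ walk) w≢y | no w∉p | no w∉q =
      prepend w≢y w∉p w∉q wv (meet walk v≢y)

  module _ (twoConnected : TwoConnected G) where

    private
      avoiding : ∀ {y} → u ≢ y → v ≢ y → Star (λ u v → u ≢ y × v ≢ y × Adjacent u v) u v
      avoiding {y = y} = proj₂ (proj₂ twoConnected) y

      shift : Linkage f x y → Adjacent y x → Adjacent y w → Linkage f w y
      shift Λ yx@(_ , yx′) yw@(_ , yw′) =
        linkage-shift Λ yx yw (avoiding (joins-≢ yw′ ∘ sym) (joins-≢ yx′ ∘ sym))

      -- This takes the place of Menger's theorem: being linked to f passes from an edge to any edge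
      -- sharing an end with it, so it spreads from f itself along a walk.
      along : Linkage f x y → Adjacent y x →
              Star (λ u v → ⊤ × ⊤ × Adjacent u v) y v → ∃ λ u → Linkage f u v × Adjacent v u
      along Λ yx ε                          = _ , Λ , yx
      along Λ yx ((_ , _ , g , yw) ◅ walk) =
        along (linkage-swap (shift Λ yx (g , yw))) (g , ≈-swapʳ yw) walk

      trivial : ∀ f → Linkage f (proj₁ (ends G f)) (proj₂ (ends G f))
      trivial f = linkage ≈-refl [] []
        λ { (here refl , here eq) → joins-≢ {g = f} ≈-refl eq }

    linked : ∀ f → Joins e x y → Linkage f x y
    linked f xy
      with _ , Λ , yu ← along (trivial f) (f , ≈-swapʳ ≈-refl) (proj₁ (proj₂ twoConnected) tt tt)
      = linkage-swap (shift Λ yu (_ , xy))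

  -- Closing a linkage into a cycle through e and f.

  _∈ᴾ_ : Edge G → Path t x l → Set
  g ∈ᴾ []           = ⊥
  g ∈ᴾ step h _ _ p = g ≡ h ⊎ g ∈ᴾ p

  ∈ᴾ-ends : (p : Path t x l) → g ∈ᴾ p → Joins g u v → u ∈ x ∷ l
  ∈ᴾ-ends (step h j _ p) (inj₁ refl) uv with joins-end uv j
  ... | inj₁ refl = here refl
  ... | inj₂ refl = there (here refl)
  ∈ᴾ-ends (step h j _ p) (inj₂ g∈)   uv = there (∈ᴾ-ends p g∈ uv)

  -- The head of the first path is moved onto the second, one vertex at a time, and the edge it
  -- leaves by becomes the new connecting edge. Tracking `g` and the edges of the second path is
  -- what the recursion preserves, and it suffices to find e on the result.
  reverse-onto : Path t x l → (q : Path t′ y l′) → Joins g x y → Disjoint (x ∷ l) (y ∷ l′) →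
    ∃ λ k → Σ (Path t′ t k) λ p → (∀ {h} → h ≡ g ⊎ h ∈ᴾ q → h ∈ᴾ p)
                                × (∀ {v} → v ∈ t ∷ k → v ∈ x ∷ l ⊎ v ∈ y ∷ l′)
  reverse-onto {g = g} [] q xy disj =
    _ , step g xy (λ x∈ → disj (here refl , x∈)) q , id ,
    λ { (here refl) → inj₁ (here refl) ; (there v∈) → inj₂ v∈ }
  reverse-onto {g = g} (step h xz x∉ p) q xy disj
    with k , r , edges , vertices ←
      reverse-onto p (step g xy (λ x∈ → disj (here refl , x∈)) q) (≈-swapʳ xz)
        (λ { (v∈ , here refl) → x∉ v∈ ; (v∈ , there v∈′) → disj (there v∈ , v∈′) })
    = k , r , edges ∘ inj₂ , regroup ∘ vertices
    where
    regroup : ∀ {v x l l′} → v ∈ l ⊎ v ∈ x ∷ l′ → v ∈ x ∷ l ⊎ v ∈ l′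
    regroup (inj₁ v∈)          = inj₁ (there v∈)
    regroup (inj₂ (here refl)) = inj₁ (here refl)
    regroup (inj₂ (there v∈))  = inj₂ v∈

  lookup-injective : Path t x l → Injective _≡_ _≡_ (lookup (x ∷ l))
  lookup-injective p              {zero}  {zero}  _  = refl
  lookup-injective p              {zero}  {suc j} eq =
    contradiction (subst (_∈ _) (sym eq) (∈-lookup j)) (head∉tail p)
  lookup-injective p              {suc i} {zero}  eq =
    contradiction (subst (_∈ _) eq (∈-lookup i)) (head∉tail p)
  lookup-injective (step _ _ _ p) {suc i} {suc j} eq = cong suc (lookup-injective p eq)

  module Close (f : Edge G) where

    edgeAt : Path t x l → Fin (ℕ.suc (length l)) → Edge G
    edgeAt []             _       = f
    edgeAt (step g _ _ p) zero    = g
    edgeAt (step g _ _ p) (suc i) = edgeAt p i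

    edgeAt-∈ : (p : Path t x l) → ∀ i → edgeAt p i ≡ f ⊎ edgeAt p i ∈ᴾ p
    edgeAt-∈ []             _       = inj₁ refl
    edgeAt-∈ (step _ _ _ p) zero    = inj₂ (inj₁ refl)
    edgeAt-∈ (step _ _ _ p) (suc i) = [ inj₁ , inj₂ ∘ inj₂ ]′ (edgeAt-∈ p i)

    edgeAt-onto : (p : Path t x l) → g ∈ᴾ p → ∃ λ i → edgeAt p i ≡ g
    edgeAt-onto (step _ _ _ p) (inj₁ refl) = zero , refl
    edgeAt-onto (step _ _ _ p) (inj₂ g∈) with i , eq ← edgeAt-onto p g∈ = suc i , eq

    edgeAt-last : (p : Path t x l) → edgeAt p (fromℕ (length l)) ≡ f
    edgeAt-last []             = refl
    edgeAt-last (step _ _ _ p) = edgeAt-last p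

    target-last : Path t x l → lookup (x ∷ l) (fromℕ (length l)) ≡ t
    target-last []             = refl
    target-last (step _ _ _ p) = target-last p

    edgeAt-consecutive : (p : Path t x l) (i : Fin (length l)) →
      Joins (edgeAt p (inject₁ i)) (lookup (x ∷ l) (inject₁ i)) (lookup (x ∷ l) (suc i))
    edgeAt-consecutive (step _ xy _ p) zero    = xy
    edgeAt-consecutive (step _ _ _ p)  (suc i) = edgeAt-consecutive p i

    first≢ : (p : Path t y l) → Joins g x y → x ∉ y ∷ l → g ≢ f → ∀ i → g ≢ edgeAt p i
    first≢ p xy x∉ g≢f i refl with edgeAt-∈ p i
    ... | inj₁ eq = g≢f eq
    ... | inj₂ g∈ = x∉ (∈ᴾ-ends p g∈ xy)

    edgeAt-injective : (p : Path t x l) → ¬ f ∈ᴾ p → Injective _≡_ _≡_ (edgeAt p)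
    edgeAt-injective []               f∉ {zero}  {zero}  _  = refl
    edgeAt-injective (step _ _ _ p)   f∉ {zero}  {zero}  _  = refl
    edgeAt-injective (step _ xy x∉ p) f∉ {zero}  {suc j} eq =
      contradiction eq (first≢ p xy x∉ (λ { refl → f∉ (inj₁ refl) }) j)
    edgeAt-injective (step _ xy x∉ p) f∉ {suc i} {zero}  eq =
      contradiction (sym eq) (first≢ p xy x∉ (λ { refl → f∉ (inj₁ refl) }) i)
    edgeAt-injective (step _ _ _ p)   f∉ {suc i} {suc j} eq =
      cong suc (edgeAt-injective p (f∉ ∘ inj₂) eq)

    -- A path between the ends of f that uses f consists of f alone, since `x` and `t` are met only
    -- once; but e lies on this path.
    closing∉ : (p : Path t x l) → Joins f t x → e ≢ f → e ∈ᴾ p → ¬ f ∈ᴾ p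
    closing∉ (step _ _ x∉ p)  tx e≢f e∈          (inj₂ f∈)   = x∉ (∈ᴾ-ends p f∈ (≈-swapʳ tx))
    closing∉ (step _ _ _ _)   tx e≢f (inj₁ refl) (inj₁ refl) = e≢f refl
    closing∉ (step _ xy x∉ p) tx e≢f (inj₂ e∈)   (inj₁ refl) with ≈-pair (≈-swapʳ tx) xy
    ... | inj₂ (x≡y , _) = x∉ (here x≡y)
    ... | inj₁ (_ , refl) with p
    ...   | []            = e∈
    ...   | step _ _ t∉ q = t∉ (target∈ q)

    cycle : (p : Path t x l) → Joins f t x → e ≢ f → e ∈ᴾ p → Cycle G
    cycle {x = x} {l = l} p tx e≢f e∈ = record
      { vertex           = lookup (x ∷ l)
      ; edge             = edgeAt p
      ; vertex-injective = lookup-injective p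
      ; edge-injective   = edgeAt-injective p (closing∉ p tx e≢f e∈)
      ; consecutive      = edgeAt-consecutive p
      ; closing          = closes
      }
      where
      closes : Joins (edgeAt p (fromℕ _)) (lookup (x ∷ l) (fromℕ _)) x
      closes rewrite edgeAt-last p | target-last p = tx

  Spans : Linkage f x y → Set
  Spans {x = x} {y = y} Λ = ∀ v → v ∈ x ∷ tail₁ Λ ⊎ v ∈ y ∷ tail₂ Λ

  -- The cycle runs back along `left`, through e, along `right` and home through f, so its vertices
  -- are those of the linkage.
  linkage-spans : e ≢ f → ((C : Cycle G) → e ∈ᴱ C → f ∈ᴱ C → Hamiltonian C) →
                  Joins e x y → (Λ : Linkage f x y) → Spans Λ
  linkage-spans {f = f} e≢f ham xy Λ v
    with k , p , edges , vertices ← reverse-onto (left Λ) (right Λ) xy (disjoint Λ)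
    with i , refl ← ham (Close.cycle f p (≈-swapʳ (target Λ)) e≢f (edges (inj₁ refl)))
                        (Close.edgeAt-onto f p (edges (inj₁ refl)))
                        (fromℕ _ , Close.edgeAt-last f p) v
    = vertices (∈-lookup i)

-- The part of the graph already swept, and its current rung.

module Ladders (G : Graph) (simple : Simple G) (f : Edge G) where

  open Paths G simple

  -- A renumbered subgraph of G, which ι and κ embed.
  record Drawing : Set where
    no-eta-equality
    field
      {order size} : ℕ
      es           : Vector (Fin order × Fin order) size
      ι            : Fin order → Vertex G
      κ            : Fin size → Edge G
      ι-injective  : Injective _≡_ _≡_ ι
      κ-injective  : Injective _≡_ _≡_ κ
      compat       : ∀ k → ends G (κ k) ≈ mapₚ ι (es k)

    Covered : Vertex G → Set
    Covered v = ∃ λ u → ι u ≡ v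

    Drawn : Edge G → Set
    Drawn g = ∃ λ k → κ k ≡ g

    covered? : ∀ v → Dec (Covered v)
    covered? v = any? λ u → ι u ≟ v

    drawn-covered : ∀ {g u v} → Drawn g → Joins g u v → Covered u
    drawn-covered (k , refl) uv with joins-end uv (compat k)
    ... | inj₁ eq = _ , sym eq
    ... | inj₂ eq = _ , sym eq

  open Drawing using (ι; ι-injective; Covered; Drawn; covered?; drawn-covered)

  Point : Drawing → Set
  Point D = Fin (Drawing.order D)

  private variable
    t t′ u v w x y z : Vertex G
    g h : Edge G
    l l′ : List (Vertex G)

  addVertex : (D : Drawing) (z : Vertex G) → ¬ Covered D z → Drawing
  addVertex D z z∉ = record
    { es          = mapₚ suc ∘ D.es
    ; ι           = z Vector.∷ D.ι
    ; κ           = D.κ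
    ; ι-injective = ∷-injective z∉ D.ι-injective
    ; κ-injective = D.κ-injective
    ; compat      = D.compat
    }
    where module D = Drawing D

  addEdge : (D : Drawing) (a b : Point D) → Joins g (ι D a) (ι D b) → ¬ Drawn D g → Drawing
  addEdge {g = g} D a b ab g∉ = record
    { es          = (a , b) Vector.∷ D.es
    ; ι           = D.ι
    ; κ           = g Vector.∷ D.κ
    ; ι-injective = D.ι-injective
    ; κ-injective = ∷-injective g∉ D.κ-injective
    ; compat      = λ { zero → ab ; (suc k) → D.compat k }
    }
    where module D = Drawing D

  -- `residual` is the hypothesis on cycles, relative to the part of G already drawn: the
  -- tails of any linkage that continues from the current rung cover the rest of G.
  record Front (D : Drawing) (a b : Point D) : Set where
    field
      a≢b      : a ≢ b
      frontier : Joins g u v → Covered D u → ¬ Covered D v → u ≡ ι D a ⊎ u ≡ ι D b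
      residual : (Λ : Linkage f (ι D a) (ι D b)) → let open Linkage Λ in
                 (∀ {v} → v ∈ tail₁ ⊎ v ∈ tail₂ → ¬ Covered D v) →
                 ∀ {v} → ¬ Covered D v → v ∈ tail₁ ⊎ v ∈ tail₂

    ιa≢ιb : ι D a ≢ ι D b
    ιa≢ιb = a≢b ∘ ι-injective D

  front-swap : ∀ {D} {a b : Point D} → Front D a b → Front D b a
  front-swap F = record
    { a≢b      = a≢b ∘ sym
    ; frontier = λ uv u∈ v∉ → Sum.swap (frontier uv u∈ v∉)
    ; residual = λ Λ out v∉ → Sum.swap (residual (linkage-swap Λ) (out ∘ Sum.swap) v∉)
    }
    where open Front F

  -- The root of the graph stands for the current rung.  In a ReadyState it is virtual, and
  -- the rung is also drawn if G has it; in a GrownState the rung is not drawn, so that the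
  -- root itself can play its part.
  record ReadyState (D : Drawing) (a b : Point D) : Set where
    field
      {r}      : Point D × Point D
      r≈       : r ≈ (a , b)
      front    : Front D a b
      complete : Joins g u v → Covered D u → Covered D v → Drawn D g
      ready    : Ready (graph r (Drawing.es D)) zero

  record GrownState (D : Drawing) (a b : Point D) : Set where
    field
      {r}      : Point D × Point D
      r≈       : r ≈ (a , b)
      front    : Front D a b
      complete : Joins g u v → Covered D u → Covered D v → Drawn D g ⊎ Joins g (ι D a) (ι D b)
      rootless : Drawn D g → ¬ Joins g (ι D a) (ι D b)
      isGrown  : Grown (graph r (Drawing.es D)) zero

  ready-swap : ∀ {D} {a b : Point D} → ReadyState D a b → ReadyState D b a
  ready-swap R = record
    { r≈ = ≈-swapʳ r≈ ; front = front-swap front ; complete = complete ; ready = ready }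
    where open ReadyState R

  grown-swap : ∀ {D} {a b : Point D} → GrownState D a b → GrownState D b a
  grown-swap S = record
    { r≈       = ≈-swapʳ r≈
    ; front    = front-swap front
    ; complete = λ uv u∈ v∈ → Sum.map₂ ≈-swapʳ (complete uv u∈ v∈)
    ; rootless = λ g∈ → rootless g∈ ∘ ≈-swapʳ
    ; isGrown  = isGrown
    }
    where open GrownState S

  -- The rung is not in $G$, so it is right that the next 2-sum deletes the root.
  dropRoot : ∀ {D} {a b : Point D} →
             GrownState D a b → ¬ Adjacent (ι D a) (ι D b) → ReadyState D a b
  dropRoot S ¬ab = record
    { r≈       = r≈
    ; front    = front
    ; complete = λ uv u∈ v∈ →
        [ id , (λ ab → contradiction (_ , ab) ¬ab) ]′ (complete uv u∈ v∈)
    ; ready    = partial (Grown.part isGrown)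
    }
    where open GrownState S

  keepRoot : ∀ {D} {a b : Point D} →
             (S : GrownState D a b) (ab : Joins g (ι D a) (ι D b)) →
             ReadyState (addEdge D a b ab (λ g∈ → GrownState.rootless S g∈ ab)) a b
  keepRoot S ab = record
    { r≈       = r≈
    -- The new drawing has one more edge but the same vertices, and the fields of `Front` speak of
    -- vertices only.
    ; front    = record { Front front }
    ; complete = λ uv u∈ v∈ →
        [ (λ (k , eq) → suc k , eq) , (λ ab′ → zero , joins-unique ab ab′)
        ]′ (complete uv u∈ v∈)
    ; ready    = doubleRoot (Front.a≢b front) r≈ ≈-refl isGrown
    }
    where open GrownState S

  -- Passing a triangle or a K₄.

  module _ {D a b} (R : ReadyState D a b) (z∉ : ¬ Covered D z) (az : Joins g (ι D a) z)
           (only : ∀ {h v} → ¬ Covered D v → Joins h (ι D a) v → v ≡ z) where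

    private
      module R = ReadyState R
      module F = Front R.front

    triangle : Drawing
    triangle = addEdge (addVertex D z z∉) (suc a) zero az
                       (λ g∈ → z∉ (drawn-covered D g∈ (≈-swapʳ az)))

    private
      weaken : Covered D v → Covered triangle v
      weaken (u , eq) = suc u , eq

      from-z : Joins h z v → Covered D v → Drawn triangle h ⊎ Joins h z (ι D b)
      from-z zv v∈ with F.frontier (≈-swapʳ zv) v∈ z∉
      ... | inj₁ refl = inj₁ (zero , joins-unique az (≈-swapʳ zv))
      ... | inj₂ refl = inj₂ zv

    -- By `only`, nothing undrawn is adjacent to `a` any more, so the frontier moves to z and `b`.
    -- Prefixing the edge az turns a linkage from the new rung into one from the old, which carries
    -- `residual` over.
    triangle-grown : GrownState triangle zero (suc b)
    triangle-grown = record
      { r≈       = ≈-refl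
      ; front    = record { a≢b = λ () ; frontier = frontier ; residual = residual }
      ; complete = complete
      ; rootless = rootless
      ; isGrown  = growTriangle F.a≢b R.r≈ ≈-refl R.ready
      }
      where
      frontier : Joins h u v → Covered triangle u → ¬ Covered triangle v → u ≡ z ⊎ u ≡ ι D b
      frontier uv (zero , refl) v∉ = inj₁ refl
      frontier uv (suc k , eq)  v∉ with F.frontier uv (k , eq) (v∉ ∘ weaken)
      ... | inj₁ refl = contradiction (zero , sym (only (v∉ ∘ weaken) uv)) v∉
      ... | inj₂ u≡b  = inj₂ u≡b

      residual : (Λ : Linkage f z (ι D b)) → let open Linkage Λ in
                 (∀ {v} → v ∈ tail₁ ⊎ v ∈ tail₂ → ¬ Covered triangle v) →
                 ∀ {v} → ¬ Covered triangle v → v ∈ tail₁ ⊎ v ∈ tail₂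
      residual (linkage target p q disj) out v∉
        with F.residual
          (linkage target
            (step _ az (λ { (here refl) → z∉ (a , refl)
                          ; (there a∈)  → out (inj₁ a∈) (suc a , refl) }) p) q
            λ { (here refl , here eq)  → F.ιa≢ιb eq
              ; (here refl , there a∈) → out (inj₂ a∈) (suc a , refl)
              ; (there v∈ , v∈′)       → disj (v∈ , v∈′) })
          (λ { (inj₁ (here refl)) → z∉
             ; (inj₁ (there v∈))  → out (inj₁ v∈) ∘ weaken
             ; (inj₂ v∈)          → out (inj₂ v∈) ∘ weaken })
          (v∉ ∘ weaken)
      ... | inj₁ (here refl) = contradiction (zero , refl) v∉
      ... | inj₁ (there v∈)  = inj₁ v∈
      ... | inj₂ v∈          = inj₂ v∈

      complete : Joins h u v → Covered triangle u → Covered triangle v →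
                 Drawn triangle h ⊎ Joins h z (ι D b)
      complete uv (zero , refl) (zero , eq)   = contradiction eq (joins-≢ uv)
      complete uv (zero , refl) (suc k , eq)  = from-z uv (k , eq)
      complete uv (suc j , eq)  (zero , refl) = from-z (≈-swapʳ uv) (j , eq)
      complete uv (suc j , eq)  (suc k , eq′) with R.complete uv (j , eq) (k , eq′)
      ... | i , h≡ = inj₁ (suc i , h≡)

      rootless : Drawn triangle h → ¬ Joins h z (ι D b)
      rootless (suc k , eq)  zb = z∉ (drawn-covered D (k , eq) zb)
      rootless (zero , refl) zb with ≈-pair (≈-swapʳ az) zb
      ... | inj₁ (_ , a≡b) = F.ιa≢ιb a≡b
      ... | inj₂ (z≡b , _) = z∉ (_ , sym z≡b)

  module _ (D : Drawing) {a b : Point D} (a≢b : a ≢ b) (z∉ : ¬ Covered D z)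
           (az : Joins g (ι D a) z) (bz : Joins h (ι D b) z) where

    -- Half of a K₄. Applied to z and then to w, it lists the edges in the order of `growK₄`, so
    -- that the two graphs agree by definition.
    attach : Drawing
    attach = addEdge (addEdge (addVertex D z z∉) (suc a) zero az
                              (λ g∈ → z∉ (drawn-covered D g∈ (≈-swapʳ az))))
                     (suc b) zero bz h∉
      where
      h∉ : ¬ (∃ λ k → (g Vector.∷ Drawing.κ D) k ≡ h)
      h∉ (suc k , eq)  = z∉ (drawn-covered D (k , eq) (≈-swapʳ bz))
      h∉ (zero , refl) with ≈-pair az bz
      ... | inj₁ (eq , _) = a≢b (ι-injective D eq)
      ... | inj₂ (eq , _) = z∉ (_ , eq)

  module _ {D a b} (R : ReadyState D a b)
           (z∉ : ¬ Covered D z) (w∉ : ¬ Covered D w) (z≢w : z ≢ w)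
           {g₁ g₂ g₃ g₄ : Edge G}
           (az : Joins g₁ (ι D a) z) (bz : Joins g₂ (ι D b) z)
           (aw : Joins g₃ (ι D a) w) (bw : Joins g₄ (ι D b) w)
           (only-a : ∀ {h v} → ¬ Covered D v → Joins h (ι D a) v → v ≡ z ⊎ v ≡ w)
           (only-b : ∀ {h v} → ¬ Covered D v → Joins h (ι D b) v → v ≡ z ⊎ v ≡ w) where

    private
      module R = ReadyState R
      module F = Front R.front

      half : Drawing
      half = attach D F.a≢b z∉ az bz

      w∉half : ¬ Covered half w
      w∉half (zero , z≡w)  = z≢w z≡w
      w∉half (suc k , eq) = w∉ (k , eq)

    crossing : Drawing
    crossing = attach half {suc a} {suc b} (λ { refl → F.a≢b refl }) w∉half aw bw

    private
      weaken : Covered D v → Covered crossing v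
      weaken (u , eq) = suc (suc u) , eq

      from-z : Joins h z v → Covered D v → Drawn crossing h
      from-z zv v∈ with F.frontier (≈-swapʳ zv) v∈ z∉
      ... | inj₁ refl = suc (suc (suc zero)) , joins-unique az (≈-swapʳ zv)
      ... | inj₂ refl = suc (suc zero) , joins-unique bz (≈-swapʳ zv)

      from-w : Joins h w v → Covered D v → Drawn crossing h
      from-w wv v∈ with F.frontier (≈-swapʳ wv) v∈ w∉
      ... | inj₁ refl = suc zero , joins-unique aw (≈-swapʳ wv)
      ... | inj₂ refl = zero , joins-unique bw (≈-swapʳ wv)

    -- Both `a` and `b` leave the frontier at once, as their undrawn neighbours were among z and w.
    -- For `residual`, the path edges az and bw are prefixed; the edge zw, if there is one, is left
    -- to the root.
    crossing-grown : GrownState crossing 1F 0F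
    crossing-grown = record
      { r≈       = ≈-refl
      ; front    = record { a≢b = λ () ; frontier = frontier ; residual = residual }
      ; complete = complete
      ; rootless = rootless
      ; isGrown  = growK₄ F.a≢b R.r≈ ≈-refl R.ready
      }
      where
      inside : v ≡ z ⊎ v ≡ w → Covered crossing v
      inside (inj₁ refl) = 1F , refl
      inside (inj₂ refl) = 0F , refl

      frontier : Joins h u v → Covered crossing u → ¬ Covered crossing v → u ≡ z ⊎ u ≡ w
      frontier uv (0F , refl) v∉ = inj₂ refl
      frontier uv (1F , refl) v∉ = inj₁ refl
      frontier uv (suc (suc k) , eq) v∉ with F.frontier uv (k , eq) (v∉ ∘ weaken)
      ... | inj₁ refl = contradiction (inside (only-a (v∉ ∘ weaken) uv)) v∉
      ... | inj₂ refl = contradiction (inside (only-b (v∉ ∘ weaken) uv)) v∉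

      residual : (Λ : Linkage f z w) → let open Linkage Λ in
                 (∀ {v} → v ∈ tail₁ ⊎ v ∈ tail₂ → ¬ Covered crossing v) →
                 ∀ {v} → ¬ Covered crossing v → v ∈ tail₁ ⊎ v ∈ tail₂
      residual (linkage target p q disj) out v∉
        with F.residual
          (linkage target
            (step _ az (λ { (here refl) → z∉ (a , refl)
                          ; (there a∈)  → out (inj₁ a∈) (weaken (a , refl)) }) p)
            (step _ bw (λ { (here refl) → w∉ (b , refl)
                          ; (there b∈)  → out (inj₂ b∈) (weaken (b , refl)) }) q)
            λ { (here refl , here eq)          → F.ιa≢ιb eq
              ; (here refl , there (here eq))  → w∉ (_ , eq)
              ; (here refl , there (there a∈)) → out (inj₂ a∈) (weaken (a , refl))
              ; (there (here eq) , here refl)  → z∉ (_ , eq)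
              ; (there (there b∈) , here refl) → out (inj₁ b∈) (weaken (b , refl))
              ; (there v∈ , there v∈′)         → disj (v∈ , v∈′) })
          (λ { (inj₁ (here refl)) → z∉
             ; (inj₁ (there v∈))  → out (inj₁ v∈) ∘ weaken
             ; (inj₂ (here refl)) → w∉
             ; (inj₂ (there v∈))  → out (inj₂ v∈) ∘ weaken })
          (v∉ ∘ weaken)
      ... | inj₁ (here refl) = contradiction (1F , refl) v∉
      ... | inj₁ (there v∈)  = inj₁ v∈
      ... | inj₂ (here refl) = contradiction (0F , refl) v∉
      ... | inj₂ (there v∈)  = inj₂ v∈

      complete : Joins h u v → Covered crossing u → Covered crossing v →
                 Drawn crossing h ⊎ Joins h z w
      complete uv (0F , refl) (0F , eq)            = contradiction eq (joins-≢ uv)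
      complete uv (0F , refl) (1F , refl)          = inj₂ (≈-swapʳ uv)
      complete uv (0F , refl) (suc (suc k) , eq)   = inj₁ (from-w uv (k , eq))
      complete uv (1F , refl) (0F , refl)          = inj₂ uv
      complete uv (1F , refl) (1F , eq)            = contradiction eq (joins-≢ uv)
      complete uv (1F , refl) (suc (suc k) , eq)   = inj₁ (from-z uv (k , eq))
      complete uv (suc (suc j) , eq) (0F , refl)   = inj₁ (from-w (≈-swapʳ uv) (j , eq))
      complete uv (suc (suc j) , eq) (1F , refl)   = inj₁ (from-z (≈-swapʳ uv) (j , eq))
      complete uv (suc (suc j) , eq) (suc (suc k) , eq′) with R.complete uv (j , eq) (k , eq′)
      ... | i , h≡ = inj₁ (suc (suc (suc (suc i))) , h≡)

      rootless : Drawn crossing h → ¬ Joins h z w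
      rootless (suc (suc k) , eq) zw = w∉half (drawn-covered half (k , eq) (≈-swapʳ zw))
      rootless (0F , refl) zw with joins-end zw bw
      ... | inj₁ z≡b = z∉ (_ , sym z≡b)
      ... | inj₂ z≡w = z≢w z≡w
      rootless (1F , refl) zw with joins-end zw aw
      ... | inj₁ z≡a = z∉ (_ , sym z≡a)
      ... | inj₂ z≡w = z≢w z≡w

  -- Which edges can lead from the current rung into the undrawn rest of P and Q.

  record Fits (D : Drawing) (a b : Point D) (l l′ : List (Vertex G)) : Set where
    constructor fits
    field
      disjoint : Disjoint (ι D a ∷ l) (ι D b ∷ l′)
      outside  : ∀ {v} → v ∈ l ⊎ v ∈ l′ → ¬ Covered D v

  fits-swap : ∀ {D} {a b : Point D} → Fits D a b l l′ → Fits D b a l′ l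
  fits-swap (fits disj out) = fits (λ (v∈ , v∈′) → disj (v∈′ , v∈)) (out ∘ Sum.swap)

  -- Going straight from `a` to v would give a linkage that skips the undrawn vertex z, against
  -- `residual`.
  no-chord : ∀ {D} {a b : Point D} →
             Front D a b → Joins f t t′ → ι D a ∉ z ∷ l → Path t z l → Path t′ (ι D b) l′ →
             Fits D a b (z ∷ l) l′ → Joins g (ι D a) v → v ∉ l
  no-chord F target a∉ p q (fits disj out) av v∈ with k , p′ , ⊆l ← shortcut p v∈
    with Front.residual F
      (linkage target (step _ av (a∉ ∘ there ∘ ⊆l) p′) q
        λ { (here refl , v∈′) → disj (here refl , v∈′)
          ; (there v∈ , v∈′)  → disj (there (there (⊆l v∈)) , v∈′) })
      (λ { (inj₁ v∈) → out (inj₁ (there (⊆l v∈))) ; (inj₂ v∈) → out (inj₂ v∈) })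
      (out (inj₁ (here refl)))
  ... | inj₁ z∈ = head∉tail p (⊆l z∈)
  ... | inj₂ z∈ = disj (there (here refl) , there z∈)

  -- Let the path from `a` cross to x and continue on Q, and the one from `b` cross to y and
  -- continue on P. The two have exchanged their ends of f, which is harmless, but they skip z
  -- unless y is z. The mirror image identifies x with w.
  cross-next : ∀ {D} {a b : Point D} → Front D a b → Joins f t t′ →
               ι D a ∉ z ∷ l → Path t z l → ι D b ∉ w ∷ l′ → Path t′ w l′ →
               Fits D a b (z ∷ l) (w ∷ l′) →
               Joins g (ι D a) x → x ∈ w ∷ l′ → Joins h (ι D b) y → y ∈ z ∷ l → y ≡ z
  cross-next F target a∉ p b∉ q _ ax x∈ by (here y≡z) = y≡z
  cross-next F target a∉ p b∉ q (fits disj out) ax x∈ by (there y∈)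
    with k , p′ , ⊆l ← shortcut p y∈
    with k′ , q′ , ⊆l′ ← tail-from q x∈
    with Front.residual F
      (linkage (≈-swapʳ target)
        (step _ ax (λ a∈ → disj (here refl , there (⊆l′ a∈))) q′)
        (step _ by (λ b∈ → disj (there (there (⊆l b∈)) , here refl)) p′)
        λ { (here refl , here eq)   → disj (here refl , here eq)
          ; (here refl , there a∈)  → a∉ (there (⊆l a∈))
          ; (there b∈ , here refl)  → b∉ (⊆l′ b∈)
          ; (there v∈ , there v∈′)  → disj (there (there (⊆l v∈′)) , there (⊆l′ v∈)) })
      (λ { (inj₁ v∈) → out (inj₂ (⊆l′ v∈)) ; (inj₂ v∈) → out (inj₁ (there (⊆l v∈))) })
      (out (inj₁ (here refl)))
  ... | inj₁ z∈ = contradiction (there (here refl) , there (⊆l′ z∈)) disj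
  ... | inj₂ z∈ = contradiction (⊆l z∈) (head∉tail p)

  module Next {D} {a b : Point D} (F : Front D a b) (target : Joins f t t′)
              (az : Joins g (ι D a) z)
              (a∉ : ι D a ∉ z ∷ l) (p : Path t z l) (q : Path t′ (ι D b) l′)
              (fit : Fits D a b (z ∷ l) l′) where

    -- By `residual` the two paths contain everything undrawn, and on P the absence of chords leaves
    -- z alone.
    next-or-across : ¬ Covered D v → Joins h (ι D a) v → v ≡ z ⊎ v ∈ l′
    next-or-across v∉ av
      with Front.residual F (linkage target (step _ az a∉ p) q (Fits.disjoint fit))
                            (Fits.outside fit) v∉
    ... | inj₁ (here v≡z) = inj₁ v≡z
    ... | inj₁ (there v∈) = contradiction v∈ (no-chord F target a∉ p q fit av)
    ... | inj₂ v∈         = inj₂ v∈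

    next-only : ¬ Any (Adjacent (ι D a)) l′ → ¬ Covered D v → Joins h (ι D a) v → v ≡ z
    next-only ¬across v∉ av with next-or-across v∉ av
    ... | inj₁ v≡z = v≡z
    ... | inj₂ v∈  = contradiction (lose v∈ (_ , av)) ¬across

  -- The sweep has arrived at f, so the root is read as f: it has index zero in the ladder and is
  -- sent to f, which `rootless` has kept undrawn. By `residual`, empty tails mean that no vertex is
  -- missing.
  finished : ∀ {D} {a b : Point D} →
             GrownState D a b → Joins f (ι D a) (ι D b) → Fits D a b [] [] → CleanLadder G
  finished {D = D} S f-root (fits disj out) =
    CleanLadder-resp-≅ (Grown.ladder isGrown)
      (iso (ι D) (ι-injective D) all-covered
           (f Vector.∷ κ) (∷-injective (λ f∈ → rootless f∈ f-root) κ-injective) all-drawn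
           λ { zero    → ≈-trans f-root (≈-sym (≈-map (ι D) r≈))
             ; (suc k) → compat k })
    where
    open GrownState S
    open Drawing D using (κ; κ-injective; compat)

    all-covered : ∀ v → Covered D v
    all-covered v with covered? D v
    ... | yes v∈ = v∈
    ... | no v∉ with Front.residual front (linkage f-root [] [] disj) out v∉
    ...   | inj₁ ()
    ...   | inj₂ ()

    all-drawn : ∀ g → ∃ λ k → (f Vector.∷ κ) k ≡ g
    all-drawn g with complete {g} ≈-refl (all-covered _) (all-covered _)
    ... | inj₁ (k , eq) = suc k , eq
    ... | inj₂ g-root   = zero , joins-unique f-root g-root

  -- The sweep along P and Q.

  build : ∀ {D} {a b : Point D} →
          GrownState D a b → Joins f t t′ → Path t (ι D a) l → Path t′ (ι D b) l′ →
          Fits D a b l l′ → CleanLadder G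

  extendLeft : ∀ {D} {a b : Point D} →
               ReadyState D a b → Joins f t t′ → Joins g (ι D a) z → ι D a ∉ z ∷ l →
               Path t z l → Path t′ (ι D b) l′ → Fits D a b (z ∷ l) l′ →
               ¬ Any (Adjacent (ι D a)) l′ → CleanLadder G

  extendRight : ∀ {D} {a b : Point D} →
                ReadyState D a b → Joins f t t′ → Joins g (ι D b) w → ι D b ∉ w ∷ l′ →
                Path t (ι D a) l → Path t′ w l′ → Fits D a b l (w ∷ l′) →
                ¬ Any (Adjacent (ι D b)) l → CleanLadder G

  extendBoth : ∀ {D} {a b : Point D} → ReadyState D a b → Joins f t t′ →
               Joins g (ι D a) z → ι D a ∉ z ∷ l → Path t z l →
               Joins h (ι D b) w → ι D b ∉ w ∷ l′ → Path t′ w l′ →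
               Adjacent (ι D a) w × Adjacent (ι D b) z →
               Fits D a b (z ∷ l) (w ∷ l′) → CleanLadder G

  branch : ∀ {D} {a b : Point D} →
           GrownState D a b → Joins f t t′ → Path t (ι D a) l → Path t′ (ι D b) l′ →
           Fits D a b l l′ → (l ≡ [] → l′ ≢ []) →
           Dec (Adjacent (ι D a) (ι D b)) → CleanLadder G

  advance : ∀ {D} {a b : Point D} →
            ReadyState D a b → Joins f t t′ → Path t (ι D a) l → Path t′ (ι D b) l′ →
            Fits D a b l l′ → (l ≡ [] → l′ ≢ []) → CleanLadder G

  private
    fits-next : ∀ {D} {a b : Point D} (R : ReadyState D a b)
                (z∉ : ¬ Covered D z) (az : Joins g (ι D a) z)
                (only : ∀ {h v} → ¬ Covered D v → Joins h (ι D a) v → v ≡ z) →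
                Path t z l → Fits D a b (z ∷ l) l′ →
                Fits (triangle R z∉ az only) zero (suc b) l l′
    fits-next R z∉ az only p (fits disj out) = fits (λ (v∈ , v∈′) → disj (there v∈ , v∈′))
      λ { (inj₁ v∈) (zero , refl) → head∉tail p v∈
        ; (inj₂ v∈) (zero , refl) → disj (there (here refl) , there v∈)
        ; (inj₁ v∈) (suc k , eq)  → out (inj₁ (there v∈)) (k , eq)
        ; (inj₂ v∈) (suc k , eq)  → out (inj₂ v∈) (k , eq) }

  extendLeft {z = z} {D = D} {a = a} R target az a∉ p q fit ¬across =
    build (triangle-grown R z∉ az only) target p q (fits-next R z∉ az only p fit)
    where
    z∉ = Fits.outside fit (inj₁ (here refl))
    only : ∀ {h v} → ¬ Covered D v → Joins h (ι D a) v → v ≡ z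
    only v∉ av = Next.next-only (ReadyState.front R) target az a∉ p q fit ¬across v∉ av

  extendRight {w = w} {D = D} {b = b} R target bw b∉ p q fit ¬across =
    build (grown-swap (triangle-grown (ready-swap R) w∉ bw only)) target p q
          (fits-swap (fits-next (ready-swap R) w∉ bw only q (fits-swap fit)))
    where
    w∉ = Fits.outside fit (inj₂ (here refl))
    only : ∀ {h v} → ¬ Covered D v → Joins h (ι D b) v → v ≡ w
    only v∉ bv = Next.next-only (front-swap (ReadyState.front R)) (≈-swapʳ target) bw b∉ q p
                                (fits-swap fit) ¬across v∉ bv

  extendBoth {z = z} {l = l} {w = w} {l′ = l′} {D = D} {a = a} {b = b}
             R target az a∉ p bw b∉ q ((_ , aw) , (_ , bz)) fit@(fits disj out) =
    build (crossing-grown R z∉ w∉ z≢w az bz aw bw only-a only-b)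
          target p q (fits (λ (v∈ , v∈′) → disj (there v∈ , there v∈′)) out′)
    where
    front = ReadyState.front R
    z∉    = out (inj₁ (here refl))
    w∉    = out (inj₂ (here refl))

    z≢w : z ≢ w
    z≢w refl = disj (there (here refl) , there (here refl))

    only-a : ∀ {h v} → ¬ Covered D v → Joins h (ι D a) v → v ≡ z ⊎ v ≡ w
    -- As `b` is adjacent to z, any rung from `a` to Q crosses that one, and so it must end in w.
    only-a v∉ av =
      Sum.map₂ (cross-next (front-swap front) (≈-swapʳ target) b∉ q a∉ p (fits-swap fit)
                           bz (here refl) av)
               (Next.next-or-across front target az a∉ p (step _ bw b∉ q) fit v∉ av)

    only-b : ∀ {h v} → ¬ Covered D v → Joins h (ι D b) v → v ≡ z ⊎ v ≡ w
    only-b v∉ bv = Sum.swap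
      (Sum.map₂ (cross-next front target a∉ p b∉ q fit aw (here refl) bv)
                (Next.next-or-across (front-swap front) (≈-swapʳ target) bw b∉ q
                                     (step _ az a∉ p) (fits-swap fit) v∉ bv))

    out′ : ∀ {v} → v ∈ l ⊎ v ∈ l′ →
           ¬ Covered (crossing R z∉ w∉ z≢w az bz aw bw only-a only-b) v
    out′ (inj₁ v∈) (0F , refl) = disj (there (there v∈) , there (here refl))
    out′ (inj₂ v∈) (0F , refl) = head∉tail q v∈
    out′ (inj₁ v∈) (1F , refl) = head∉tail p v∈
    out′ (inj₂ v∈) (1F , refl) = disj (there (here refl) , there (there v∈))
    out′ (inj₁ v∈) (suc (suc k) , eq) = out (inj₁ (there v∈)) (k , eq)
    out′ (inj₂ v∈) (suc (suc k) , eq) = out (inj₂ (there v∈)) (k , eq)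

  advance R target [] [] fit ≢[] = contradiction refl (≢[] refl)
  advance {l = _ ∷ _} R target (step _ az a∉ p) [] fit _ =
    extendLeft R target az a∉ p [] fit λ ()
  advance {l′ = _ ∷ _} R target [] (step _ bw b∉ q) fit _ =
    extendRight R target bw b∉ [] q fit λ ()
  advance {l = z ∷ l} {l′ = w ∷ l′} {D = D} {a = a} {b = b} R target
          p̂@(step _ az a∉ p) q̂@(step _ bw b∉ q) fit _ =
    [ (λ across →
        [ (λ across′ → extendBoth R target az a∉ p bw b∉ q (crosses across across′) fit)
        , extendRight R target bw b∉ p̂ q fit
        ]′ (toSum (Any.any? (adjacent? (ι D b)) (z ∷ l))))
    , extendLeft R target az a∉ p q̂ fit
    ]′ (toSum (Any.any? (adjacent? (ι D a)) (w ∷ l′)))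
    where
    crosses : Any (Adjacent (ι D a)) (w ∷ l′) → Any (Adjacent (ι D b)) (z ∷ l) →
              Adjacent (ι D a) w × Adjacent (ι D b) z
    crosses across across′
      with _ , x∈ , _ , ax ← find across
      with _ , y∈ , _ , by ← find across′
      -- Whichever neighbours across the search has found, they are z and w.
      with refl ← cross-next (ReadyState.front R) target a∉ p b∉ q fit ax x∈ by y∈
      with refl ← cross-next (front-swap (ReadyState.front R)) (≈-swapʳ target) b∉ q a∉ p
                             (fits-swap fit) by y∈ ax x∈
      = (_ , ax) , (_ , by)

  branch S target p q fit ≢[] (no ¬ab) = advance (dropRoot S ¬ab) target p q fit ≢[]
  branch S target p q fit ≢[] (yes (_ , ab)) =
    advance (keepRoot S ab) target p q (record { Fits fit }) ≢[]

  -- The lists are matched for the termination checker: they decrease along the sweep.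
  build {l = []} {l′ = []} S target [] [] fit = finished S target fit
  build {l = _ ∷ _} S target p q fit =
    branch S target p q fit (λ ()) (adjacent? _ _)
  build {l = []} {l′ = _ ∷ _} S target p q fit =
    branch S target p q fit (λ _ ()) (adjacent? _ _)

  -- The edge e is drawn and a virtual parallel edge is the root: together they are the digon. With
  -- only x and y drawn, `residual` says no more than that every linkage spans.
  initial : ∀ {e x y} → Joins e x y →
            ((Λ : Linkage f x y) → Spans Λ) →
            ∃ λ D → ∃ λ a → ∃ λ b → ReadyState D a b × ι D a ≡ x × ι D b ≡ y ×
            (∀ {v} → Covered D v → v ≡ x ⊎ v ≡ y)
  initial {e} {x} {y} xy spans = D₀ , 0F , 1F , record
    { r≈       = ≈-refl
    ; front    = record
      { a≢b      = λ ()
      ; frontier = λ _ u∈ _ → covered u∈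
      ; residual = λ Λ _ v∉ → Sum.map (Any.tail λ { refl → v∉ (0F , refl) })
                                      (Any.tail λ { refl → v∉ (1F , refl) }) (spans Λ _)
      }
    ; complete = λ uv u∈ v∈ → zero , complete uv (covered u∈) (covered v∈)
    ; ready    = digon (record
      { all-ends = λ { 0F → inj₁ refl ; 1F → inj₂ refl }
      ; other    = 1F
      ; other≢   = λ ()
      ; only     = λ { 0F 0≢0 → contradiction refl 0≢0 ; 1F _ → refl }
      ; parallel = ≈-refl
      })
    } , refl , refl , covered
    where
    D₀ : Drawing
    D₀ = record
      { es          = (0F , 1F) Vector.∷ Vector.[]
      ; ι           = x Vector.∷ y Vector.∷ Vector.[]
      ; κ           = e Vector.∷ Vector.[]
      ; ι-injective = ∷-injective (λ { (zero , y≡x) → joins-≢ xy (sym y≡x) ; (suc () , _) })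
                                  (∷-injective (λ ()) λ { {()} })
      ; κ-injective = ∷-injective (λ ()) λ { {()} }
      ; compat      = λ { 0F → xy }
      }

    covered : Covered D₀ v → v ≡ x ⊎ v ≡ y
    covered (0F , eq) = inj₁ (sym eq)
    covered (1F , eq) = inj₂ (sym eq)

    complete : Joins g u v → u ≡ x ⊎ u ≡ y → v ≡ x ⊎ v ≡ y → e ≡ g
    complete uv (inj₁ refl) (inj₁ refl) = contradiction refl (joins-≢ uv)
    complete uv (inj₁ refl) (inj₂ refl) = joins-unique xy uv
    complete uv (inj₂ refl) (inj₁ refl) = joins-unique xy (≈-swapʳ uv)
    complete uv (inj₂ refl) (inj₂ refl) = contradiction refl (joins-≢ uv)

  -- Guarantees a first step of the sweep: were both paths trivial, e and f would be parallel, hence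
  -- equal.
  degenerate : Joins g x y → Joins h t t′ → Path t x [] → Path t′ y [] → g ≡ h
  degenerate xy tt′ [] [] = joins-unique xy tt′

  cleanLadder : ∀ {e x y} → Joins e x y → e ≢ f → ((Λ : Linkage f x y) → Spans Λ) →
                Linkage f x y → CleanLadder G
  cleanLadder xy e≢f spans (linkage target p q disj)
    with D , a , b , R , refl , refl , covered ← initial xy spans
    = advance R target p q (fits disj λ
        { (inj₁ v∈) → [ (λ { refl → head∉tail p v∈ })
                      , (λ { refl → disj (there v∈ , here refl) }) ]′ ∘ covered
        ; (inj₂ v∈) → [ (λ { refl → disj (here refl , there v∈) })
                      , (λ { refl → head∉tail q v∈ }) ]′ ∘ covered })
      λ { refl refl → e≢f (degenerate xy target p q) }

corollary1p5 : (G : Graph) → Simple G → TwoConnected G →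
    (e f : Edge G) → e ≢ f →
    ((C : Cycle G) → e ∈ᴱ C → f ∈ᴱ C → Hamiltonian C) →
    CleanLadder G
corollary1p5 G simple twoConnected e f e≢f hamiltonian =
  cleanLadder {e = e} ≈-refl e≢f (linkage-spans e≢f hamiltonian ≈-refl)
              (linked twoConnected {e = e} f ≈-refl)
  where
  open Paths G simple
  open Ladders G simple f
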